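{- Let $\nu$ be a lattice path. Then $|\mathcal{LP}_\nu| = 2\,|\mathcal{P}_\nu|$ if and only if $\nu$ begins with a north step and ends with an east step. Here $\mathcal{P}_\nu$ is the set of (small) $\nu$-Schröder paths and $\mathcal{LP}_\nu$ is the set of large $\nu$-Schröder paths.
   Context: A lattice path from $(0,0)$ to $(b,a)\in\mathbb{Z}_{\ge 0}^2$ is a sequence of $a$ north steps $N=(0,1)$ and $b$ east steps $E=(1,0)$. A Schröder path from $(0,0)$ to $(b,a)$ is a path from $(0,0)$ to $(b,a)$ whose steps are $N=(0,1)$, $E=(1,0)$ and $D=(1,1)$. Let $\nu$ be a lattice path from $(0,0)$ to $(b,a)$. A peak of a lattice path is a consecutive pair $NE$. Let $\mu$ be the path obtained from $\nu$ by replacing each peak $NE$ of $\nu$ with a diagonal step $D$. A (small) $\nu$-Schröder path is a Schröder path from $(0,0)$ to $(b,a)$ which stays weakly above $\nu$. A large $\nu$-Schröder path is a Schröder path from $(0,0)$ to $(b,a)$ which stays weakly above $\mu$. -}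

module Defs where

open import Data.Integer using (+_)
open import Data.List using (List; []; _∷_; map; sum; length)
open import Data.List.Membership.Propositional using (_∈_)
open import Data.List.Relation.Unary.Unique.Propositional using (Unique)
open import Data.Nat as ℕ using (ℕ)
open import Data.Product using (_×_; _,_; ∃-syntax)
open import Data.Rational using (ℚ; 0ℚ; 1ℚ; _+_; _*_; _/_; _≤_)
open import Function.Bundles using (_⇔_)
open import Level using (0ℓ)
open import Relation.Binary.PropositionalEquality using (_≡_)
open import Relation.Unary using (Pred)

data LatticeStep : Set where
  N E : LatticeStep

data SchröderStep : Set where
  N E D : SchröderStep

LatticePath : Set
LatticePath = List LatticeStep

SchröderPath : Set
SchröderPath = List SchröderStep

dx dy : SchröderStep → ℕ
dx N = 0
dx E = 1
dx D = 1
dy N = 1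
dy E = 0
dy D = 1

-- All paths start at (0,0); the point (b,a) is recorded as the pair b , a.
endpoint : SchröderPath → ℕ × ℕ
endpoint p = sum (map dx p) , sum (map dy p)

toSchröderStep : LatticeStep → SchröderStep
toSchröderStep N = N
toSchröderStep E = E

toSchröder : LatticePath → SchröderPath
toSchröder = map toSchröderStep

-- The path μ.  Distinct peaks NE share no step, so they can be replaced in a
-- single pass.
contractPeaks : LatticePath → SchröderPath
contractPeaks []          = []
contractPeaks (E ∷ p)     = E ∷ contractPeaks p
contractPeaks (N ∷ E ∷ p) = D ∷ contractPeaks p
contractPeaks (N ∷ N ∷ p) = N ∷ contractPeaks (N ∷ p)
contractPeaks (N ∷ [])    = N ∷ []

ι : ℕ → ℚ
ι n = + n / 1

-- The rational points of the polygonal curve traced by a path from (0,0).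
-- Lattice points alone would not do: the step D and the peak NE have the same
-- endpoints, yet D runs strictly below NE.
data OnCurve : SchröderPath → ℚ × ℚ → Set where
  origin : OnCurve [] (0ℚ , 0ℚ)
  here   : ∀ {s p} (t : ℚ) → 0ℚ ≤ t → t ≤ 1ℚ →
           OnCurve (s ∷ p) (t * ι (dx s) , t * ι (dy s))
  there  : ∀ {s p x y} → OnCurve p (x , y) →
           OnCurve (s ∷ p) (ι (dx s) + x , ι (dy s) + y)

-- Only used for paths with the same endpoint.
infix 4 _WeaklyAbove_
_WeaklyAbove_ : SchröderPath → SchröderPath → Set
p WeaklyAbove q =
  ∀ {x y} → OnCurve p (x , y) → ∃[ y′ ] (y′ ≤ y × OnCurve q (x , y′))

-- Small ν-Schröder paths.
𝓟 : LatticePath → Pred SchröderPath 0ℓ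
𝓟 ν p = endpoint p ≡ endpoint (toSchröder ν) × p WeaklyAbove toSchröder ν

-- Large ν-Schröder paths.
𝓛𝓟 : LatticePath → Pred SchröderPath 0ℓ
𝓛𝓟 ν p = endpoint p ≡ endpoint (toSchröder ν) × p WeaklyAbove contractPeaks ν

-- The set of elements satisfying P is finite with exactly n elements.  Elements
-- are listed, rather than counting Σ A P, because P need not be
-- proof-irrelevant.
HasCardinality : {A : Set} → Pred A 0ℓ → ℕ → Set
HasCardinality {A} P n =
  ∃[ xs ] (Unique xs × (∀ (a : A) → a ∈ xs ⇔ P a) × length xs ≡ n)

{-# OPTIONS --safe #-}

-- Replacing every D of a Schröder path by NE maps the large ν-Schröder paths
-- onto the lattice paths π weakly above ν, and the fibre over π has 2 ^ peaks(π)
-- elements.  Replacing D by EN does the same for the small ν-Schröder paths, with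
-- fibres of size 2 ^ valleys(π).  Now peaks(π) ≤ valleys(π) + 1, with equality iff
-- π starts with N and ends with E.  If ν has this shape then so has every π above
-- ν, hence |LP| = 2 |P|; otherwise the term π = ν makes the inequality strict.
module Submission where

open import Defs
open import Data.List using (List; []; _∷_; _++_; map; length; head; last; concatMap; filter)
open import Data.List.Membership.Propositional using (_∈_; find; lose)
open import Data.List.Membership.Propositional.Properties
  using (∈-++⁺ˡ; ∈-++⁺ʳ; ∈-++⁻; ∈-map⁺; ∈-map⁻; ∈-concatMap⁺; ∈-concatMap⁻; ∈-filter⁺; ∈-filter⁻)
open import Data.List.Properties using (length-map; length-++; ∷-injectiveʳ)
open import Data.List.Relation.Binary.Pointwise as Pointwise using (Pointwise; []; _∷_)
open import Data.List.Relation.Unary.All as All using (All; []; _∷_)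
open import Data.List.Relation.Unary.AllPairs using ([]; _∷_)
open import Data.List.Relation.Unary.Any using (here; there)
open import Data.List.Relation.Unary.Unique.Propositional using (Unique)
import Data.List.Relation.Unary.Unique.Propositional.Properties as Unique
open import Data.Maybe using (Maybe; just; nothing)
import Data.Maybe.Properties as Maybe
open import Data.Nat as ℕ using (ℕ; zero; suc)
open import Data.Nat.ListAction using (sum)
import Data.Nat.Properties as ℕ
open import Data.Nat.Tactic.RingSolver using (solve-∀)
open import Data.Product using (_×_; _,_; ∃-syntax; proj₁; proj₂)
import Data.Product.Properties as Product
open import Data.Sum using (inj₁; inj₂)
open import Function.Base using (_∘_)
open import Function.Bundles using (_⇔_; mk⇔; Equivalence)
open import Level using (0ℓ)
open import Relation.Binary.Definitions using (tri<; tri≈; tri>)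
open import Relation.Binary.PropositionalEquality
  using (_≡_; _≢_; refl; sym; trans; cong; cong₂; subst; module ≡-Reasoning)
open import Relation.Nullary using (¬_; Dec; yes; no; contradiction)
open import Relation.Nullary.Decidable using (from-yes; _×-dec_)
open import Relation.Unary using (Pred; Decidable)

open Equivalence using (to; from)

-- `_WeaklyAbove_` quantifies over all rational points of a curve, so it has to become a finite,
-- decidable condition before anything can be counted. Between consecutive integer abscissas a path
-- is a single straight step with integer end heights. Dominance of curves is therefore dominance of
-- these end heights, column by column (`_⊒_`). This explains the two opposite expansions. Over an E
-- of ν, a D is constrained only at its left end, which is the height of the E in EN. Against μ the
-- right ends decide: a D of μ stands for a peak whose E runs at the upper height, and NE likewise
-- puts its E at the upper height of the D. Exponents never appear: fibres are explicit lists, and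
-- peaks are compared with valleys through a product identity between list lengths.

module Geometry where

  open import Algebra.Bundles using (AbelianGroup)
  open import Data.Rational using (ℚ; 0ℚ; 1ℚ; ½; _+_; _*_; _≤_; _<_; nonNegative)
  import Data.Rational.Properties as ℚ
  open import Algebra.Properties.CommutativeSemigroup
    (AbelianGroup.commutativeSemigroup ℚ.+-0-abelianGroup) using (x∙yz≈y∙xz)
  open import Algebra.Properties.Group ℚ.+-0-group using (∙-cancelˡ)

  -- Rational curves and weak dominance

  0≤1 : 0ℚ ≤ 1ℚ
  0≤1 = from-yes (0ℚ ℚ.≤? 1ℚ)

  0≤½ : 0ℚ ≤ ½
  0≤½ = from-yes (0ℚ ℚ.≤? ½)

  ½≤1 : ½ ≤ 1ℚ
  ½≤1 = from-yes (½ ℚ.≤? 1ℚ)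

  0<½ : 0ℚ < ½
  0<½ = from-yes (0ℚ ℚ.<? ½)

  ½<1 : ½ < 1ℚ
  ½<1 = from-yes (½ ℚ.<? 1ℚ)

  p≤p+q : ∀ p {q} → 0ℚ ≤ q → p ≤ p + q
  p≤p+q p {q} 0≤q = subst (_≤ p + q) (ℚ.+-identityʳ p) (ℚ.+-monoʳ-≤ p 0≤q)

  p<p+q : ∀ p {q} → 0ℚ < q → p < p + q
  p<p+q p {q} 0<q = subst (_< p + q) (ℚ.+-identityʳ p) (ℚ.+-monoʳ-< p 0<q)

  height : ℕ → ℚ
  height zero    = 0ℚ
  height (suc n) = 1ℚ + height n

  height-mono : ∀ {m n} → m ℕ.≤ n → height m ≤ height n
  height-mono {n = zero}  ℕ.z≤n = ℚ.≤-refl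
  height-mono {n = suc n} ℕ.z≤n = ℚ.≤-trans 0≤1 (p≤p+q 1ℚ (height-mono {n = n} ℕ.z≤n))
  height-mono (ℕ.s≤s m≤n)       = ℚ.+-monoʳ-≤ 1ℚ (height-mono m≤n)

  -- Distinct heights differ by at least 1, so the slack ½ left by a comparison at a midpoint cannot
  -- hide a violation.
  height-reflect : ∀ {m n} → height m ≤ height n + ½ → m ℕ.≤ n
  height-reflect {m} {n} Hm≤Hn+½ with m ℕ.≤? n
  ... | yes m≤n = m≤n
  ... | no  m≰n = contradiction
    (ℚ.≤-<-trans Hm≤Hn+½
      (ℚ.<-≤-trans (ℚ.+-monoʳ-< (height n) ½<1)
        (subst (_≤ height m) (ℚ.+-comm 1ℚ (height n)) (height-mono (ℕ.≰⇒> m≰n)))))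
    (ℚ.<-irrefl refl)

  height-dy : ∀ s n → height (dy s ℕ.+ n) ≡ ι (dy s) + height n
  height-dy N n = refl
  height-dy E n = sym (ℚ.+-identityˡ (height n))
  height-dy D n = refl

  -- The curve of `p` translated upwards by `h`, so that passing to the tail of a path only changes
  -- `h`. The height `z` is tied by an equation rather than an index, which leaves it free in later
  -- case analyses.
  data Curve (h : ℕ) (p : SchröderPath) (x z : ℚ) : Set where
    point : ∀ y → OnCurve p (x , y) → z ≡ height h + y → Curve h p x z

  0≤ι-dx : ∀ s → 0ℚ ≤ ι (dx s)
  0≤ι-dx N = ℚ.≤-refl
  0≤ι-dx E = 0≤1
  0≤ι-dx D = 0≤1

  0≤ι-dy : ∀ s → 0ℚ ≤ ι (dy s)
  0≤ι-dy N = 0≤1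
  0≤ι-dy E = ℚ.≤-refl
  0≤ι-dy D = 0≤1

  0≤* : ∀ {p q} → 0ℚ ≤ p → 0ℚ ≤ q → 0ℚ ≤ p * q
  0≤* {p} {q} 0≤p 0≤q = subst (_≤ p * q) (ℚ.*-zeroʳ p)
    (ℚ.*-monoˡ-≤-nonNeg p ⦃ nonNegative 0≤p ⦄ 0≤q)

  OnCurve⇒0≤ : ∀ {p x y} → OnCurve p (x , y) → 0ℚ ≤ x × 0ℚ ≤ y
  OnCurve⇒0≤ origin             = ℚ.≤-refl , ℚ.≤-refl
  OnCurve⇒0≤ (here {s} t 0≤t _) = 0≤* 0≤t (0≤ι-dx s) , 0≤* 0≤t (0≤ι-dy s)
  OnCurve⇒0≤ (there {s} c) with OnCurve⇒0≤ c
  ... | 0≤x , 0≤y =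
    ℚ.+-mono-≤ (0≤ι-dx s) 0≤x , ℚ.+-mono-≤ (0≤ι-dy s) 0≤y

  onCurve-start : ∀ p → OnCurve p (0ℚ , 0ℚ)
  onCurve-start []      = origin
  onCurve-start (s ∷ p) = subst (OnCurve (s ∷ p))
    (cong₂ _,_ (ℚ.*-zeroˡ (ι (dx s))) (ℚ.*-zeroˡ (ι (dy s)))) (here 0ℚ ℚ.≤-refl 0≤1)

  curve-start : ∀ h p → Curve h p 0ℚ (height h)
  curve-start h p = point 0ℚ (onCurve-start p) (sym (ℚ.+-identityʳ (height h)))

  curve-lower : ∀ {h p x z} → Curve h p x z → height h ≤ z
  curve-lower {h} (point y c refl) = p≤p+q (height h) (proj₂ (OnCurve⇒0≤ c))

  height-shift : ∀ s h y → height h + (ι (dy s) + y) ≡ height (dy s ℕ.+ h) + y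
  height-shift s h y = begin
    height h + (ι (dy s) + y)   ≡⟨ x∙yz≈y∙xz (height h) (ι (dy s)) y ⟩
    ι (dy s) + (height h + y)   ≡⟨ ℚ.+-assoc (ι (dy s)) (height h) y ⟨
    ι (dy s) + height h + y     ≡⟨ cong (_+ y) (height-dy s h) ⟨
    height (dy s ℕ.+ h) + y     ∎
    where open ≡-Reasoning

  curve-there : ∀ {h s p x z} → Curve (dy s ℕ.+ h) p x z → Curve h (s ∷ p) (ι (dx s) + x) z
  curve-there {h} {s} (point y c refl) = point (ι (dy s) + y) (there c) (sym (height-shift s h y))

  -- The indices of `OnCurve` are sums and products, which do not unify with given coordinates; here
  -- they become equations. The bound `0ℚ ≤ x′` serves to exclude the tail inside the first column.
  data CurveView (h : ℕ) (s : SchröderStep) (p : SchröderPath) (x z : ℚ) : Set where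
    on-step : ∀ t → 0ℚ ≤ t → t ≤ 1ℚ → x ≡ t * ι (dx s) → z ≡ height h + t * ι (dy s) →
              CurveView h s p x z
    on-tail : ∀ x′ → 0ℚ ≤ x′ → x ≡ ι (dx s) + x′ → Curve (dy s ℕ.+ h) p x′ z →
              CurveView h s p x z

  curve-view : ∀ {h s p x z} → Curve h (s ∷ p) x z → CurveView h s p x z
  curve-view (point _ (here t 0≤t t≤1) z≡) = on-step t 0≤t t≤1 refl z≡
  curve-view {h} {s} (point _ (there {x = x′} {y = y} c) refl) =
    on-tail x′ (proj₁ (OnCurve⇒0≤ c)) refl (point y c (height-shift s h y))

  -- The line x = 0 is left out: there the initial north steps of q count for the
  -- lower envelope of q, whereas for x > 0 they only translate the rest of q.
  Above⁺ : ℕ → ℕ → SchröderPath → SchröderPath → Set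
  Above⁺ h k p q = ∀ {x z} → 0ℚ < x → Curve h p x z → ∃[ z′ ] (z′ ≤ z × Curve k q x z′)

  north⁺ : ∀ {h p x z} → Curve (suc h) p x z → Curve h (N ∷ p) x z
  north⁺ {h} {p} {x} {z} c =
    subst (λ w → Curve h (N ∷ p) w z) (ℚ.+-identityˡ x) (curve-there {s = N} c)

  north⁻ : ∀ {h p x z} → 0ℚ < x → Curve h (N ∷ p) x z → Curve (suc h) p x z
  north⁻ {h} {p} {z = z} 0<x c with curve-view c
  ... | on-step t _ _ refl _    = contradiction (sym (ℚ.*-zeroʳ t)) (ℚ.<⇒≢ 0<x)
  ... | on-tail x′ _ refl c′    = subst (λ w → Curve (suc h) p w z) (sym (ℚ.+-identityˡ x′)) c′

  -- The hypothesis `dx s ≡ 1` treats E and D together; the parameter of such a step is its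
  -- abscissa.
  curve-step : ∀ {h s p t} → dx s ≡ 1 → 0ℚ ≤ t → t ≤ 1ℚ →
               Curve h (s ∷ p) t (height h + t * ι (dy s))
  curve-step {h} {s} {p} {t} dx≡1 0≤t t≤1 =
    point (t * ι (dy s))
      (subst (λ x → OnCurve (s ∷ p) (x , t * ι (dy s)))
        (trans (cong (λ n → t * ι n) dx≡1) (ℚ.*-identityʳ t)) (here t 0≤t t≤1))
      refl

  -- Strictness matters: over abscissa 1, north steps following `s` would contribute further points.
  view-step : ∀ {h s p t z} → dx s ≡ 1 → t < 1ℚ → Curve h (s ∷ p) t z →
              z ≡ height h + t * ι (dy s)
  view-step {h} {s} dx≡1 t<1 c with curve-view c
  ... | on-step u _ _ refl z≡ = trans z≡ (cong (λ v → height h + v * ι (dy s))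
          (sym (trans (cong (λ n → u * ι n) dx≡1) (ℚ.*-identityʳ u))))
  ... | on-tail x′ 0≤x′ refl _ = contradiction
          (ℚ.<-≤-trans t<1 (subst (λ n → 1ℚ ≤ ι n + x′) (sym dx≡1) (p≤p+q 1ℚ 0≤x′)))
          (ℚ.<-irrefl refl)

  view-tail : ∀ {h s p x z} → dx s ≡ 1 → 0ℚ < x → Curve h (s ∷ p) (1ℚ + x) z →
              Curve (dy s ℕ.+ h) p x z
  view-tail {h} {s} {p} {x} {z} dx≡1 0<x c with curve-view c
  ... | on-step u _ u≤1 1+x≡ _ = contradiction
          (ℚ.<-≤-trans (p<p+q 1ℚ 0<x)
            (subst (_≤ 1ℚ)
              (sym (trans 1+x≡ (trans (cong (λ n → u * ι n) dx≡1) (ℚ.*-identityʳ u)))) u≤1))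
          (ℚ.<-irrefl refl)
  ... | on-tail x′ _ 1+x≡ c′ = subst (λ w → Curve (dy s ℕ.+ h) p w z)
          (sym (∙-cancelˡ 1ℚ x x′ (trans 1+x≡ (cong (λ n → ι n + x′) dx≡1)))) c′

  -- The heights of the left and right endpoints of an E or D step.
  Segment : Set
  Segment = ℕ × ℕ

  infix 4 _⊒_
  _⊒_ : Segment → Segment → Set
  (h , h′) ⊒ (k , k′) = k ℕ.≤ h × k′ ℕ.≤ h′

  -- Trailing north steps leave no trace in this list, so a common endpoint is a separate condition
  -- in `_≽_`.
  segments : ℕ → SchröderPath → List Segment
  segments h []      = []
  segments h (N ∷ p) = segments (suc h) p
  segments h (E ∷ p) = (h , h) ∷ segments h p
  segments h (D ∷ p) = (h , suc h) ∷ segments (suc h) p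

  -- The midpoint decides: endpoint heights are integers, and the left endpoint of
  -- a column of q need not be the lowest point of q on its vertical line.
  midpoint⇒⊒ : ∀ {h k} s s′ → dx s ≡ 1 → dx s′ ≡ 1 →
               height k + ½ * ι (dy s′) ≤ height h + ½ * ι (dy s) →
               (h , dy s ℕ.+ h) ⊒ (k , dy s′ ℕ.+ k)
  midpoint⇒⊒ {h} {k} E E _ _ le =
    let k≤h = height-reflect (subst (_≤ height h + ½) (ℚ.+-identityʳ (height k))
                (ℚ.≤-trans le (ℚ.+-monoʳ-≤ (height h) 0≤½)))
    in k≤h , k≤h
  midpoint⇒⊒ {h} {k} E D _ _ le =
    let k<h = height-reflect (subst (_≤ height h + ½) eq
                (ℚ.+-monoˡ-≤ ½ (subst (height k + ½ ≤_) (ℚ.+-identityʳ (height h)) le)))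
    in ℕ.<⇒≤ k<h , k<h
    where
    eq : height k + ½ + ½ ≡ height (suc k)
    eq = trans (ℚ.+-assoc (height k) ½ ½) (ℚ.+-comm (height k) 1ℚ)
  midpoint⇒⊒ {h} {k} D E _ _ le =
    let k≤h = height-reflect (subst (_≤ height h + ½) (ℚ.+-identityʳ (height k)) le)
    in k≤h , ℕ.m≤n⇒m≤1+n k≤h
  midpoint⇒⊒ {h} {k} D D _ _ le =
    let k≤h = height-reflect (ℚ.≤-trans (p≤p+q (height k) 0≤½) le)
    in k≤h , ℕ.s≤s k≤h

  -- Both heights are affine in `t`, so the inequality passes from the ends of the column to its
  -- interior. Only E over D uses the right end: there the diagonal is bounded by its top.
  ⊒⇒step≤ : ∀ {h k t} s s′ → dx s ≡ 1 → dx s′ ≡ 1 → 0ℚ ≤ t → t ≤ 1ℚ →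
            (h , dy s ℕ.+ h) ⊒ (k , dy s′ ℕ.+ k) →
            height k + t * ι (dy s′) ≤ height h + t * ι (dy s)
  ⊒⇒step≤ {t = t} E E _ _ _ _ (k≤h , _) = ℚ.+-monoˡ-≤ (t * 0ℚ) (height-mono k≤h)
  ⊒⇒step≤ {t = t} D D _ _ _ _ (k≤h , _) = ℚ.+-monoˡ-≤ (t * 1ℚ) (height-mono k≤h)
  ⊒⇒step≤ {t = t} D E _ _ 0≤t _ (k≤h , _) =
    ℚ.+-mono-≤ (height-mono k≤h)
      (subst (_≤ t * 1ℚ) (sym (ℚ.*-zeroʳ t)) (0≤* 0≤t 0≤1))
  ⊒⇒step≤ {h} {k} {t} E D _ _ _ t≤1 (_ , k<h) = begin
    height k + t * 1ℚ ≡⟨ cong (height k +_) (ℚ.*-identityʳ t) ⟩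
    height k + t      ≤⟨ ℚ.+-monoʳ-≤ (height k) t≤1 ⟩
    height k + 1ℚ     ≡⟨ ℚ.+-comm (height k) 1ℚ ⟩
    height (suc k)    ≤⟨ height-mono k<h ⟩
    height h          ≡⟨ ℚ.+-identityʳ (height h) ⟨
    height h + 0ℚ     ≡⟨ cong (height h +_) (ℚ.*-zeroʳ t) ⟨
    height h + t * 0ℚ ∎
    where open ℚ.≤-Reasoning

  column⁻ : ∀ {h k} s s′ {p q} → dx s ≡ 1 → dx s′ ≡ 1 → Above⁺ h k (s ∷ p) (s′ ∷ q) →
            (h , dy s ℕ.+ h) ⊒ (k , dy s′ ℕ.+ k) × Above⁺ (dy s ℕ.+ h) (dy s′ ℕ.+ k) p q
  column⁻ {h} {k} s s′ {p} {q} dx≡1 dx′≡1 above = segment , tail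
    where
    segment : (h , dy s ℕ.+ h) ⊒ (k , dy s′ ℕ.+ k)
    segment with above 0<½ (curve-step dx≡1 0≤½ ½≤1)
    ... | z′ , z′≤z , c =
      midpoint⇒⊒ s s′ dx≡1 dx′≡1
        (subst (_≤ height h + ½ * ι (dy s)) (view-step dx′≡1 ½<1 c) z′≤z)

    tail : Above⁺ (dy s ℕ.+ h) (dy s′ ℕ.+ k) p q
    tail {x} {z} 0<x c
      with above (ℚ.<-≤-trans 0<x (subst (x ≤_) (ℚ.+-comm x 1ℚ) (p≤p+q x 0≤1)))
             (subst (λ n → Curve h (s ∷ p) (ι n + x) z) dx≡1 (curve-there c))
    ... | z′ , z′≤z , c′ = z′ , z′≤z , view-tail dx′≡1 0<x c′

  column⁺ : ∀ {h k} s s′ {p q} → dx s ≡ 1 → dx s′ ≡ 1 →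
            (h , dy s ℕ.+ h) ⊒ (k , dy s′ ℕ.+ k) → Above⁺ (dy s ℕ.+ h) (dy s′ ℕ.+ k) p q →
            Above⁺ h k (s ∷ p) (s′ ∷ q)
  column⁺ {h} {k} s s′ {p} {q} dx≡1 dx′≡1 seg above {x} {z} 0<x c with curve-view {h} c
  ... | on-step t 0≤t t≤1 refl refl =
    height k + t * ι (dy s′) ,
    ⊒⇒step≤ s s′ dx≡1 dx′≡1 0≤t t≤1 seg ,
    subst (λ w → Curve k (s′ ∷ q) w _)
      (sym (trans (cong (λ n → t * ι n) dx≡1) (ℚ.*-identityʳ t)))
      (curve-step dx′≡1 0≤t t≤1)
  ... | on-tail x′ 0≤x′ refl c′ with ℚ.<-cmp 0ℚ x′
  ...   | tri< 0<x′ _ _ = let (z′ , z′≤z , c″) = above 0<x′ c′ in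
    z′ , z′≤z ,
    subst (λ n → Curve k (s′ ∷ q) (ι n + x′) z′) (trans dx′≡1 (sym dx≡1)) (curve-there c″)
  -- `above` is silent over `x′ = 0`. Points of `p` there are no lower than its start, which the
  -- right ends of the segments place above the start of `q`.
  ...   | tri≈ _ refl _ =
    height (dy s′ ℕ.+ k) , ℚ.≤-trans (height-mono (proj₂ seg)) (curve-lower c′) ,
    subst (λ n → Curve k (s′ ∷ q) (ι n + 0ℚ) _) (trans dx′≡1 (sym dx≡1))
      (curve-there (curve-start _ q))
  ...   | tri> _ _ x′<0 = contradiction (ℚ.<-≤-trans x′<0 0≤x′) (ℚ.<-irrefl refl)

  width : SchröderPath → ℕ
  width = proj₁ ∘ endpoint

  -- North steps on either side only move a start height; equal widths prevent one path from running
  -- out of columns before the other.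
  above⁺⇒⊒ : ∀ {h k} p q → width p ≡ width q → Above⁺ h k p q →
             Pointwise _⊒_ (segments h p) (segments k q)
  above⁺⇒⊒ (N ∷ p) q w above = above⁺⇒⊒ p q w (λ 0<x → above 0<x ∘ north⁺)
  above⁺⇒⊒ p@[] (N ∷ q) w above = above⁺⇒⊒ p q w λ 0<x c →
    let (z′ , z′≤z , c′) = above 0<x c in z′ , z′≤z , north⁻ 0<x c′
  above⁺⇒⊒ p@(E ∷ _) (N ∷ q) w above = above⁺⇒⊒ p q w λ 0<x c →
    let (z′ , z′≤z , c′) = above 0<x c in z′ , z′≤z , north⁻ 0<x c′
  above⁺⇒⊒ p@(D ∷ _) (N ∷ q) w above = above⁺⇒⊒ p q w λ 0<x c →
    let (z′ , z′≤z , c′) = above 0<x c in z′ , z′≤z , north⁻ 0<x c′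
  above⁺⇒⊒ [] [] w above = []
  above⁺⇒⊒ (E ∷ p) (E ∷ q) w above with column⁻ E E refl refl above
  ... | seg , above′ = seg ∷ above⁺⇒⊒ p q (ℕ.suc-injective w) above′
  above⁺⇒⊒ (E ∷ p) (D ∷ q) w above with column⁻ E D refl refl above
  ... | seg , above′ = seg ∷ above⁺⇒⊒ p q (ℕ.suc-injective w) above′
  above⁺⇒⊒ (D ∷ p) (E ∷ q) w above with column⁻ D E refl refl above
  ... | seg , above′ = seg ∷ above⁺⇒⊒ p q (ℕ.suc-injective w) above′
  above⁺⇒⊒ (D ∷ p) (D ∷ q) w above with column⁻ D D refl refl above
  ... | seg , above′ = seg ∷ above⁺⇒⊒ p q (ℕ.suc-injective w) above′

  ⊒⇒above⁺ : ∀ {h k} p q → Pointwise _⊒_ (segments h p) (segments k q) → Above⁺ h k p q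
  ⊒⇒above⁺ (N ∷ p) q segs 0<x c = ⊒⇒above⁺ p q segs 0<x (north⁻ 0<x c)
  ⊒⇒above⁺ p@[] (N ∷ q) segs 0<x c =
    let (z′ , z′≤z , c′) = ⊒⇒above⁺ p q segs 0<x c in z′ , z′≤z , north⁺ c′
  ⊒⇒above⁺ p@(E ∷ _) (N ∷ q) segs 0<x c =
    let (z′ , z′≤z , c′) = ⊒⇒above⁺ p q segs 0<x c in z′ , z′≤z , north⁺ c′
  ⊒⇒above⁺ p@(D ∷ _) (N ∷ q) segs 0<x c =
    let (z′ , z′≤z , c′) = ⊒⇒above⁺ p q segs 0<x c in z′ , z′≤z , north⁺ c′
  ⊒⇒above⁺ [] [] _ 0<x (point _ origin _) = contradiction 0<x (ℚ.<-irrefl refl)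
  ⊒⇒above⁺ (E ∷ p) (E ∷ q) (seg ∷ segs) = column⁺ E E refl refl seg (⊒⇒above⁺ p q segs)
  ⊒⇒above⁺ (E ∷ p) (D ∷ q) (seg ∷ segs) = column⁺ E D refl refl seg (⊒⇒above⁺ p q segs)
  ⊒⇒above⁺ (D ∷ p) (E ∷ q) (seg ∷ segs) = column⁺ D E refl refl seg (⊒⇒above⁺ p q segs)
  ⊒⇒above⁺ (D ∷ p) (D ∷ q) (seg ∷ segs) = column⁺ D D refl refl seg (⊒⇒above⁺ p q segs)

  weaklyAbove⇒⊒ : ∀ p q → width p ≡ width q → p WeaklyAbove q →
                  Pointwise _⊒_ (segments 0 p) (segments 0 q)
  weaklyAbove⇒⊒ p q w above = above⁺⇒⊒ p q w λ { 0<x (point y c refl) →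
    let (y′ , y′≤y , c′) = above c in 0ℚ + y′ , ℚ.+-monoʳ-≤ 0ℚ y′≤y , point y′ c′ refl }

  ⊒⇒weaklyAbove : ∀ p q → Pointwise _⊒_ (segments 0 p) (segments 0 q) → p WeaklyAbove q
  ⊒⇒weaklyAbove p q segs {x} {y} c with ℚ.<-cmp 0ℚ x
  -- The origin lies on `q`, and no point of a curve has negative height.
  ... | tri≈ _ refl _ = 0ℚ , proj₂ (OnCurve⇒0≤ c) , onCurve-start q
  ... | tri> _ _ x<0  = contradiction (ℚ.<-≤-trans x<0 (proj₁ (OnCurve⇒0≤ c))) (ℚ.<-irrefl refl)
  ... | tri< 0<x _ _ with ⊒⇒above⁺ p q segs 0<x (point y c (sym (ℚ.+-identityˡ y)))
  ...   | _ , z′≤y , point y′ c′ refl = y′ , subst (_≤ y) (ℚ.+-identityˡ y′) z′≤y , c′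

open Geometry using (_⊒_; segments; width; weaklyAbove⇒⊒; ⊒⇒weaklyAbove)
open import Data.Nat using (_+_; _*_; _≤_; _<_)

-- Contractions of a lattice path

_≟_ : (s t : LatticeStep) → Dec (s ≡ t)
N ≟ N = yes refl
N ≟ E = no λ ()
E ≟ N = no λ ()
E ≟ E = yes refl

flipL : LatticeStep → LatticeStep
flipL N = E
flipL E = N

flipS : SchröderStep → SchröderStep
flipS N = E
flipS E = N
flipS D = D

flipL-involutive : ∀ π → map flipL (map flipL π) ≡ π
flipL-involutive []      = refl
flipL-involutive (N ∷ π) = cong (N ∷_) (flipL-involutive π)
flipL-involutive (E ∷ π) = cong (E ∷_) (flipL-involutive π)

flipS-involutive : ∀ p → map flipS (map flipS p) ≡ p
flipS-involutive []      = refl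
flipS-involutive (N ∷ p) = cong (N ∷_) (flipS-involutive p)
flipS-involutive (E ∷ p) = cong (E ∷_) (flipS-involutive p)
flipS-involutive (D ∷ p) = cong (D ∷_) (flipS-involutive p)

expand : SchröderPath → LatticePath
expand []      = []
expand (N ∷ p) = N ∷ expand p
expand (E ∷ p) = E ∷ expand p
expand (D ∷ p) = N ∷ E ∷ expand p

-- diagonals π lists the contractions of N ∷ π that start with D.
contractions diagonals : LatticePath → List SchröderPath
contractions []      = [] ∷ []
contractions (N ∷ π) = map (N ∷_) (contractions π) ++ diagonals π
contractions (E ∷ π) = map (E ∷_) (contractions π)
diagonals []      = []
diagonals (N ∷ π) = []
diagonals (E ∷ π) = map (D ∷_) (contractions π)

∈-contractions-expand : ∀ p → p ∈ contractions (expand p)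
∈-contractions-expand []      = here refl
∈-contractions-expand (N ∷ p) = ∈-++⁺ˡ (∈-map⁺ (N ∷_) (∈-contractions-expand p))
∈-contractions-expand (E ∷ p) = ∈-map⁺ (E ∷_) (∈-contractions-expand p)
∈-contractions-expand (D ∷ p) =
  ∈-++⁺ʳ (map (N ∷_) (contractions (E ∷ expand p))) (∈-map⁺ (D ∷_) (∈-contractions-expand p))

contractions⇒expand : ∀ π {p} → p ∈ contractions π → expand p ≡ π
diagonals⇒expand : ∀ π {p} → p ∈ diagonals π → expand p ≡ N ∷ π
contractions⇒expand []      (here refl) = refl
contractions⇒expand (N ∷ π) p∈ with ∈-++⁻ (map (N ∷_) (contractions π)) p∈
... | inj₂ p∈diagonals = diagonals⇒expand π p∈diagonals
... | inj₁ p∈map with ∈-map⁻ (N ∷_) p∈map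
...   | _ , q∈ , refl = cong (N ∷_) (contractions⇒expand π q∈)
contractions⇒expand (E ∷ π) p∈ with ∈-map⁻ (E ∷_) p∈
... | _ , q∈ , refl = cong (E ∷_) (contractions⇒expand π q∈)
diagonals⇒expand (E ∷ π) p∈ with ∈-map⁻ (D ∷_) p∈
... | _ , q∈ , refl = cong (λ π → N ∷ E ∷ π) (contractions⇒expand π q∈)

contractions-unique : ∀ π → Unique (contractions π)
diagonals-unique : ∀ π → Unique (diagonals π)
contractions-unique []      = [] ∷ []
contractions-unique (N ∷ π) =
  Unique.++⁺ (Unique.map⁺ ∷-injectiveʳ (contractions-unique π)) (diagonals-unique π) (disjoint π)
  where
  disjoint : ∀ π {p} → ¬ (p ∈ map (N ∷_) (contractions π) × p ∈ diagonals π)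
  disjoint (E ∷ π) (p∈map , p∈diagonals)
    with ∈-map⁻ (N ∷_) p∈map | ∈-map⁻ (D ∷_) p∈diagonals
  ... | _ , _ , refl | _ , _ , ()
contractions-unique (E ∷ π) = Unique.map⁺ ∷-injectiveʳ (contractions-unique π)
diagonals-unique []      = []
diagonals-unique (N ∷ π) = []
diagonals-unique (E ∷ π) = Unique.map⁺ ∷-injectiveʳ (contractions-unique π)

∈-contractions⇔ : ∀ π p → p ∈ contractions π ⇔ expand p ≡ π
∈-contractions⇔ π p = mk⇔ (contractions⇒expand π)
  (λ eq → subst (λ π → p ∈ contractions π) eq (∈-contractions-expand p))

-- Exchanging N and E turns peaks into valleys: expandᵛ replaces D by EN.
expandᵛ : SchröderPath → LatticePath
expandᵛ = map flipL ∘ expand ∘ map flipS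

contractionsᵛ : LatticePath → List SchröderPath
contractionsᵛ = map (map flipS) ∘ contractions ∘ map flipL

contractionsᵛ-unique : ∀ π → Unique (contractionsᵛ π)
contractionsᵛ-unique π = Unique.map⁺ injective (contractions-unique (map flipL π))
  where
  injective : ∀ {p q} → map flipS p ≡ map flipS q → p ≡ q
  injective {p} {q} eq =
    trans (sym (flipS-involutive p)) (trans (cong (map flipS) eq) (flipS-involutive q))

∈-contractionsᵛ⇔ : ∀ π p → p ∈ contractionsᵛ π ⇔ expandᵛ p ≡ π
∈-contractionsᵛ⇔ π p = mk⇔ ⇒ ⇐
  where
  ⇒ : p ∈ contractionsᵛ π → expandᵛ p ≡ π
  ⇒ p∈ with ∈-map⁻ (map flipS) p∈
  ... | q , q∈ , refl = begin
    map flipL (expand (map flipS (map flipS q))) ≡⟨ cong (map flipL ∘ expand) (flipS-involutive q) ⟩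
    map flipL (expand q)                         ≡⟨ cong (map flipL) (contractions⇒expand _ q∈) ⟩
    map flipL (map flipL π)                      ≡⟨ flipL-involutive π ⟩
    π                                            ∎
    where open ≡-Reasoning
  ⇐ : expandᵛ p ≡ π → p ∈ contractionsᵛ π
  ⇐ refl = subst (_∈ contractionsᵛ π) (flipS-involutive p)
    (∈-map⁺ (map flipS) (subst (λ π → map flipS p ∈ contractions π)
      (sym (flipL-involutive (expand (map flipS p)))) (∈-contractions-expand (map flipS p))))

-- Comparing the two fibre sizes over one lattice path

#contractions #contractionsᵛ : LatticePath → ℕ
#contractions  = length ∘ contractions
#contractionsᵛ = length ∘ contractionsᵛ

-- 2 ^ peaks and 2 ^ valleys are compared by the identity
-- peaks + [π does not start with N] + [π does not end with E] = valleys + 1;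
-- for π = [] only the first bracket is counted.
startWeight endWeight : Maybe LatticeStep → ℕ
startWeight (just N) = 1
startWeight _        = 2
endWeight (just N) = 2
endWeight _        = 1

#contractions-E∷ : ∀ π → #contractions (E ∷ π) ≡ #contractions π
#contractions-E∷ π = length-map (E ∷_) (contractions π)

#contractions-NN∷ : ∀ π → #contractions (N ∷ N ∷ π) ≡ #contractions (N ∷ π)
#contractions-NN∷ π = begin
  length (map (N ∷_) (contractions (N ∷ π)) ++ []) ≡⟨ length-++ (map (N ∷_) (contractions (N ∷ π))) ⟩
  length (map (N ∷_) (contractions (N ∷ π))) + 0   ≡⟨ ℕ.+-identityʳ _ ⟩
  length (map (N ∷_) (contractions (N ∷ π)))       ≡⟨ length-map (N ∷_) (contractions (N ∷ π)) ⟩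
  length (contractions (N ∷ π))                    ∎
  where open ≡-Reasoning

-- The initial peak is kept or contracted. Its E belongs to no other peak, so both choices leave
-- equally many contractions of the rest.
#contractions-NE∷ : ∀ π → #contractions (N ∷ E ∷ π) ≡ 2 * #contractions (E ∷ π)
#contractions-NE∷ π = begin
  length (map (N ∷_) (contractions (E ∷ π)) ++ map (D ∷_) (contractions π))
    ≡⟨ length-++ (map (N ∷_) (contractions (E ∷ π))) ⟩
  length (map (N ∷_) (contractions (E ∷ π))) + length (map (D ∷_) (contractions π))
    ≡⟨ cong₂ _+_ (length-map (N ∷_) (contractions (E ∷ π))) (length-map (D ∷_) (contractions π)) ⟩
  #contractions (E ∷ π) + #contractions π
    ≡⟨ cong (#contractions (E ∷ π) +_) (trans (sym (#contractions-E∷ π)) (sym (ℕ.+-identityʳ _))) ⟩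
  2 * #contractions (E ∷ π) ∎
  where open ≡-Reasoning

weight : LatticePath → ℕ
weight π = startWeight (head π) * endWeight (last π)

-- Induction on the first two steps. Repeating the first step changes no factor. Putting N before E
-- creates a peak, which pays for the factor 2 lost from `startWeight`; putting E before N creates a
-- valley, matched by the factor 2 gained there.
#contractions*weight : ∀ π → #contractions π * weight π ≡ 2 * #contractions (map flipL π)
#contractions*weight []          = refl
#contractions*weight (N ∷ [])    = refl
#contractions*weight (E ∷ [])    = refl
#contractions*weight (N ∷ N ∷ π) = begin
  #contractions (N ∷ N ∷ π) * w                ≡⟨ cong (_* w) (#contractions-NN∷ π) ⟩
  #contractions (N ∷ π) * w                    ≡⟨ #contractions*weight (N ∷ π) ⟩
  2 * #contractions (E ∷ map flipL π)          ≡⟨ cong (2 *_) (#contractions-E∷ (E ∷ map flipL π)) ⟨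
  2 * #contractions (E ∷ E ∷ map flipL π)      ∎
  where
  open ≡-Reasoning
  w = weight (N ∷ π)
#contractions*weight (E ∷ E ∷ π) = begin
  #contractions (E ∷ E ∷ π) * w                ≡⟨ cong (_* w) (#contractions-E∷ (E ∷ π)) ⟩
  #contractions (E ∷ π) * w                    ≡⟨ #contractions*weight (E ∷ π) ⟩
  2 * #contractions (N ∷ map flipL π)          ≡⟨ cong (2 *_) (#contractions-NN∷ (map flipL π)) ⟨
  2 * #contractions (N ∷ N ∷ map flipL π)      ∎
  where
  open ≡-Reasoning
  w = weight (E ∷ π)
#contractions*weight (N ∷ E ∷ π) = begin
  #contractions (N ∷ E ∷ π) * (1 * w)          ≡⟨ cong (_* (1 * w)) (#contractions-NE∷ π) ⟩
  2 * #contractions (E ∷ π) * (1 * w)          ≡⟨ lemma (#contractions (E ∷ π)) w ⟩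
  #contractions (E ∷ π) * (2 * w)              ≡⟨ #contractions*weight (E ∷ π) ⟩
  2 * #contractions (N ∷ map flipL π)          ≡⟨ cong (2 *_) (#contractions-E∷ (N ∷ map flipL π)) ⟨
  2 * #contractions (E ∷ N ∷ map flipL π)      ∎
  where
  open ≡-Reasoning
  w = endWeight (last (E ∷ π))
  lemma : ∀ c w → 2 * c * (1 * w) ≡ c * (2 * w)
  lemma = solve-∀
#contractions*weight (E ∷ N ∷ π) = begin
  #contractions (E ∷ N ∷ π) * (2 * w)          ≡⟨ cong (_* (2 * w)) (#contractions-E∷ (N ∷ π)) ⟩
  #contractions (N ∷ π) * (2 * w)              ≡⟨ lemma (#contractions (N ∷ π)) w ⟩
  2 * (#contractions (N ∷ π) * (1 * w))        ≡⟨ cong (2 *_) (#contractions*weight (N ∷ π)) ⟩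
  2 * (2 * #contractions (E ∷ map flipL π))    ≡⟨ cong (2 *_) (#contractions-NE∷ (map flipL π)) ⟨
  2 * #contractions (N ∷ E ∷ map flipL π)      ∎
  where
  open ≡-Reasoning
  w = endWeight (last (N ∷ π))
  lemma : ∀ c w → c * (2 * w) ≡ 2 * (c * (1 * w))
  lemma = solve-∀

#contractions>0 : ∀ π → 0 < #contractions π
#contractions>0 []      = ℕ.s≤s ℕ.z≤n
#contractions>0 (E ∷ π) = subst (0 <_) (sym (#contractions-E∷ π)) (#contractions>0 π)
#contractions>0 (N ∷ []) = ℕ.s≤s ℕ.z≤n
#contractions>0 (N ∷ N ∷ π) = subst (0 <_) (sym (#contractions-NN∷ π)) (#contractions>0 (N ∷ π))
#contractions>0 (N ∷ E ∷ π) = subst (0 <_) (sym (#contractions-NE∷ π))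
  (ℕ.≤-trans (#contractions>0 (E ∷ π)) (ℕ.m≤m+n _ _))

StartsNorthEndsEast : LatticePath → Set
StartsNorthEndsEast π = head π ≡ just N × last π ≡ just E

#contractions*weight≡2#contractionsᵛ : ∀ π → #contractions π * weight π ≡ 2 * #contractionsᵛ π
#contractions*weight≡2#contractionsᵛ π = trans (#contractions*weight π)
  (cong (2 *_) (sym (length-map (map flipS) (contractions (map flipL π)))))

balanced : ∀ π → StartsNorthEndsEast π → #contractions π ≡ 2 * #contractionsᵛ π
balanced π (start , end) = begin
  #contractions π            ≡⟨ ℕ.*-identityʳ (#contractions π) ⟨
  #contractions π * 1        ≡⟨ cong (#contractions π *_)
                                  (cong₂ (λ s e → startWeight s * endWeight e) start end) ⟨
  #contractions π * weight π ≡⟨ #contractions*weight≡2#contractionsᵛ π ⟩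
  2 * #contractionsᵛ π       ∎
  where open ≡-Reasoning

last-∷≢nothing : ∀ {A : Set} {x : A} xs → last (x ∷ xs) ≢ nothing
last-∷≢nothing (_ ∷ xs) = last-∷≢nothing xs

endWeight>0 : ∀ s → 0 < endWeight s
endWeight>0 (just N) = ℕ.s≤s ℕ.z≤n
endWeight>0 (just E) = ℕ.≤-refl
endWeight>0 nothing  = ℕ.≤-refl

weight>1 : ∀ π → ¬ StartsNorthEndsEast π → 1 < weight π
weight>1 []      _          = ℕ.≤-refl
weight>1 (E ∷ π) _          = ℕ.*-monoʳ-≤ 2 (endWeight>0 (last (E ∷ π)))
weight>1 (N ∷ π) ¬balanced with last (N ∷ π) in eq
... | just N  = ℕ.≤-refl
... | just E  = contradiction (refl , refl) ¬balanced
... | nothing = contradiction eq (last-∷≢nothing π)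

unbalanced : ∀ π → ¬ StartsNorthEndsEast π → #contractions π < 2 * #contractionsᵛ π
unbalanced π ¬balanced = begin-strict
  #contractions π            ≡⟨ ℕ.*-identityʳ (#contractions π) ⟨
  #contractions π * 1        <⟨ ℕ.*-monoʳ-< (#contractions π)
                                  ⦃ ℕ.>-nonZero (#contractions>0 π) ⦄ (weight>1 π ¬balanced) ⟩
  #contractions π * weight π ≡⟨ #contractions*weight≡2#contractionsᵛ π ⟩
  2 * #contractionsᵛ π       ∎
  where open ℕ.≤-Reasoning

startsNorthEndsEast? : Decidable StartsNorthEndsEast
startsNorthEndsEast? π = Maybe.≡-dec _≟_ (head π) (just N) ×-dec Maybe.≡-dec _≟_ (last π) (just E)

#contractions≤ : ∀ π → #contractions π ≤ 2 * #contractionsᵛ π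
#contractions≤ π with startsNorthEndsEast? π
... | yes good = ℕ.≤-reflexive (balanced π good)
... | no  bad  = ℕ.<⇒≤ (unbalanced π bad)

-- Sums and cardinalities

module _ {A : Set} (f g : A → ℕ) where
  sum-≤-double : (∀ a → f a ≤ 2 * g a) → ∀ xs → sum (map f xs) ≤ 2 * sum (map g xs)
  sum-≤-double f≤2g []       = ℕ.z≤n
  sum-≤-double f≤2g (x ∷ xs) = subst (f x + sum (map f xs) ≤_)
    (sym (ℕ.*-distribˡ-+ 2 (g x) (sum (map g xs)))) (ℕ.+-mono-≤ (f≤2g x) (sum-≤-double f≤2g xs))

  sum-<-double : (∀ a → f a ≤ 2 * g a) → ∀ {a xs} → a ∈ xs → f a < 2 * g a →
               sum (map f xs) < 2 * sum (map g xs)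
  sum-<-double f≤2g {a} {_ ∷ xs} (here refl) fa<2ga = subst (f a + sum (map f xs) <_)
    (sym (ℕ.*-distribˡ-+ 2 (g a) (sum (map g xs)))) (ℕ.+-mono-<-≤ fa<2ga (sum-≤-double f≤2g xs))
  sum-<-double f≤2g {a} {x ∷ xs} (there a∈xs) fa<2ga = subst (f x + sum (map f xs) <_)
    (sym (ℕ.*-distribˡ-+ 2 (g x) (sum (map g xs))))
    (ℕ.+-mono-≤-< (f≤2g x) (sum-<-double f≤2g a∈xs fa<2ga))

  sum-≡-double : ∀ {xs} → All (λ a → f a ≡ 2 * g a) xs → sum (map f xs) ≡ 2 * sum (map g xs)
  sum-≡-double []                     = refl
  sum-≡-double {x ∷ xs} (fx≡2gx ∷ eqs) =
    trans (cong₂ _+_ fx≡2gx (sum-≡-double eqs)) (sym (ℕ.*-distribˡ-+ 2 (g x) (sum (map g xs))))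

module _ {A B : Set} (f : A → B) (fibre : B → List A)
  (∈-fibre⇔ : ∀ b a → a ∈ fibre b ⇔ f a ≡ b) (fibre-unique : ∀ b → Unique (fibre b)) where

  length-concatMap : ∀ bs → length (concatMap fibre bs) ≡ sum (map (length ∘ fibre) bs)
  length-concatMap []       = refl
  length-concatMap (b ∷ bs) =
    trans (length-++ (fibre b)) (cong (length (fibre b) +_) (length-concatMap bs))

  ∈-fibres⁻ : ∀ {a} bs → a ∈ concatMap fibre bs → f a ∈ bs
  ∈-fibres⁻ {a} bs a∈ with find (∈-concatMap⁻ fibre {xs = bs} a∈)
  ... | b , b∈bs , a∈fibre = subst (_∈ bs) (sym (to (∈-fibre⇔ b a) a∈fibre)) b∈bs

  ∈-fibres⁺ : ∀ {a} bs → f a ∈ bs → a ∈ concatMap fibre bs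
  ∈-fibres⁺ {a} bs fa∈bs = ∈-concatMap⁺ fibre (lose fa∈bs (from (∈-fibre⇔ (f a) a) refl))

  fibres-unique : ∀ {bs} → Unique bs → Unique (concatMap fibre bs)
  fibres-unique []                          = []
  fibres-unique {b ∷ bs} (b∉bs ∷ bs-unique) =
    Unique.++⁺ (fibre-unique b) (fibres-unique bs-unique) λ { {a} (a∈fibre , a∈fibres) →
      All.lookup b∉bs (∈-fibres⁻ bs a∈fibres) (sym (to (∈-fibre⇔ b a) a∈fibre)) }

  -- An element determines its value under `f`, so fibres over distinct points are disjoint and
  -- their concatenation lists the preimage without repetition.
  hasCardinality-preimage : {P : Pred A 0ℓ} {Q : Pred B 0ℓ} (bs : List B) → Unique bs →
    (∀ b → b ∈ bs ⇔ Q b) → (∀ a → P a ⇔ Q (f a)) →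
    HasCardinality P (sum (map (length ∘ fibre) bs))
  hasCardinality-preimage bs bs-unique ∈⇔Q P⇔Q∘f =
    concatMap fibre bs , fibres-unique bs-unique ,
    (λ a → mk⇔ (from (P⇔Q∘f a) ∘ to (∈⇔Q (f a)) ∘ ∈-fibres⁻ bs)
               (∈-fibres⁺ bs ∘ from (∈⇔Q (f a)) ∘ to (P⇔Q∘f a))) ,
    length-concatMap bs

-- Lattice paths above ν

words : ℕ → List LatticePath
words zero    = [] ∷ []
words (suc n) = map (N ∷_) (words n) ++ map (E ∷_) (words n)

words-unique : ∀ n → Unique (words n)
words-unique zero    = [] ∷ []
words-unique (suc n) = Unique.++⁺ (Unique.map⁺ ∷-injectiveʳ (words-unique n))
  (Unique.map⁺ ∷-injectiveʳ (words-unique n)) λ (p∈N , p∈E) → disjoint p∈N p∈E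
  where
  disjoint : ∀ {p} → p ∈ map (N ∷_) (words n) → ¬ p ∈ map (E ∷_) (words n)
  disjoint p∈N p∈E with ∈-map⁻ (N ∷_) p∈N | ∈-map⁻ (E ∷_) p∈E
  ... | _ , _ , refl | _ , _ , ()

∈-words : ∀ π → π ∈ words (length π)
∈-words []      = here refl
∈-words (N ∷ π) = ∈-++⁺ˡ (∈-map⁺ (N ∷_) (∈-words π))
∈-words (E ∷ π) = ∈-++⁺ʳ (map (N ∷_) (words (length π))) (∈-map⁺ (E ∷_) (∈-words π))

infix 4 _≽_
_≽_ : LatticePath → LatticePath → Set
π ≽ ν = endpoint (toSchröder π) ≡ endpoint (toSchröder ν) ×
        Pointwise _⊒_ (segments 0 (toSchröder π)) (segments 0 (toSchröder ν))

≽-refl : ∀ ν → ν ≽ ν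
≽-refl ν = refl , Pointwise.refl (ℕ.≤-refl , ℕ.≤-refl)

_≽?_ : ∀ π ν → Dec (π ≽ ν)
π ≽? ν = Product.≡-dec ℕ._≟_ ℕ._≟_ _ _ ×-dec
         Pointwise.decidable (λ (h , h′) (k , k′) → k ℕ.≤? h ×-dec k′ ℕ.≤? h′) _ _

rise : SchröderPath → ℕ
rise = proj₂ ∘ endpoint

length≡width+rise : ∀ π → length π ≡ width (toSchröder π) + rise (toSchröder π)
length≡width+rise []      = refl
length≡width+rise (N ∷ π) = trans (cong suc (length≡width+rise π)) (sym (ℕ.+-suc _ _))
length≡width+rise (E ∷ π) = cong suc (length≡width+rise π)

-- Lattice paths with the same endpoint have the same length, so a search among the words as long as
-- `ν` is exhaustive.
pathsAbove : LatticePath → List LatticePath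
pathsAbove ν = filter (_≽? ν) (words (length ν))

pathsAbove-unique : ∀ ν → Unique (pathsAbove ν)
pathsAbove-unique ν = Unique.filter⁺ (_≽? ν) (words-unique (length ν))

∈-pathsAbove⇔ : ∀ ν π → π ∈ pathsAbove ν ⇔ π ≽ ν
∈-pathsAbove⇔ ν π = mk⇔ (λ π∈ → proj₂ (∈-filter⁻ (_≽? ν) {xs = words (length ν)} π∈))
  λ π≽ν → ∈-filter⁺ (_≽? ν) (subst (λ n → π ∈ words n) (length≡ π≽ν) (∈-words π)) π≽ν
  where
  length≡ : π ≽ ν → length π ≡ length ν
  length≡ (end≡ , _) = trans (length≡width+rise π)
    (trans (cong (λ (b , a) → b + a) end≡) (sym (length≡width+rise ν)))

-- Excludes a path starting with E above one starting with N: north steps only raise the first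
-- column of the lower path further above 0, and without any column the lists differ in length.
¬0⊒segments : ∀ {k segs} ν → ¬ Pointwise _⊒_ ((0 , 0) ∷ segs) (segments (suc k) (toSchröder ν))
¬0⊒segments (N ∷ ν) segs            = ¬0⊒segments ν segs
¬0⊒segments (E ∷ ν) ((() , _) ∷ _)

≽-head : ∀ π ν → π ≽ ν → head ν ≡ just N → head π ≡ just N
≽-head []      (N ∷ ν) (() , _)   refl
≽-head (N ∷ π) (N ∷ ν) _          refl = refl
≽-head (E ∷ π) (N ∷ ν) (_ , segs) refl = contradiction segs (¬0⊒segments ν)

last-∷⁺ : ∀ {A : Set} {x y : A} xs → last xs ≡ just y → last (x ∷ xs) ≡ just y
last-∷⁺ (_ ∷ _) eq = eq

-- The last column of `ν` already runs at the common final height. The last column of `π` is no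
-- lower, which leaves no rise for a north step after it.
last-E : ∀ {h k} π ν → Pointwise _⊒_ (segments h (toSchröder π)) (segments k (toSchröder ν)) →
         h + rise (toSchröder π) ≡ k + rise (toSchröder ν) →
         last ν ≡ just E → last π ≡ just E
last-E {h} (N ∷ π) ν segs eq lastν =
  last-∷⁺ π (last-E π ν segs (trans (sym (ℕ.+-suc h _)) eq) lastν)
last-E {k = k} π (N ∷ ν@(_ ∷ _)) segs eq lastν =
  last-E π ν segs (trans eq (ℕ.+-suc k _)) lastν
last-E (E ∷ [])    (E ∷ _)       _                  _  _ = refl
-- Here `k` is the final height, yet `π` climbs strictly above `h` and `k ≤ h`.
last-E {h} (E ∷ N ∷ _) (E ∷ [])  ((k≤h , _) ∷ _) eq _ =
  contradiction (sym (trans eq (ℕ.+-identityʳ _)))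
    (ℕ.<⇒≢ (ℕ.≤-<-trans k≤h (ℕ.m<m+n h (ℕ.s≤s ℕ.z≤n))))
last-E (E ∷ π@(_ ∷ _))    (E ∷ ν@(_ ∷ _)) (_ ∷ segs) eq lastν = last-E π ν segs eq lastν

≽-last : ∀ π ν → π ≽ ν → last ν ≡ just E → last π ≡ just E
≽-last π ν (end≡ , segs) = last-E {0} {0} π ν segs (cong proj₂ end≡)

≽-startsNorthEndsEast : ∀ π ν → π ≽ ν → StartsNorthEndsEast ν → StartsNorthEndsEast π
≽-startsNorthEndsEast π ν π≽ν (start , end) = ≽-head π ν π≽ν start , ≽-last π ν π≽ν end

-- Expansion of Schröder paths into lattice paths

translate : SchröderStep → ℕ × ℕ → ℕ × ℕ
translate s (b , a) = dx s + b , dy s + a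

endpoint-expand : ∀ p → endpoint (toSchröder (expand p)) ≡ endpoint p
endpoint-expand []      = refl
endpoint-expand (N ∷ p) = cong (translate N) (endpoint-expand p)
endpoint-expand (E ∷ p) = cong (translate E) (endpoint-expand p)
endpoint-expand (D ∷ p) = cong (translate D) (endpoint-expand p)

endpoint-expandᵛ : ∀ p → endpoint (toSchröder (expandᵛ p)) ≡ endpoint p
endpoint-expandᵛ []      = refl
endpoint-expandᵛ (N ∷ p) = cong (translate N) (endpoint-expandᵛ p)
endpoint-expandᵛ (E ∷ p) = cong (translate E) (endpoint-expandᵛ p)
endpoint-expandᵛ (D ∷ p) = cong (translate D) (endpoint-expandᵛ p)

endpoint-contractPeaks : ∀ ν → endpoint (contractPeaks ν) ≡ endpoint (toSchröder ν)
endpoint-contractPeaks []          = refl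
endpoint-contractPeaks (E ∷ ν)     = cong (translate E) (endpoint-contractPeaks ν)
endpoint-contractPeaks (N ∷ [])    = refl
endpoint-contractPeaks (N ∷ E ∷ ν) = cong (translate D) (endpoint-contractPeaks ν)
endpoint-contractPeaks (N ∷ N ∷ ν) =
  cong (translate N) (endpoint-contractPeaks (N ∷ ν))

-- All columns of `ν` are horizontal, so a D above one of them is constrained only by its left end,
-- and EN keeps exactly that height.
expandᵛ-⊒⁺ : ∀ {h k} p ν → Pointwise _⊒_ (segments h p) (segments k (toSchröder ν)) →
             Pointwise _⊒_ (segments h (toSchröder (expandᵛ p))) (segments k (toSchröder ν))
expandᵛ-⊒⁺ (N ∷ p)   ν       segs                 = expandᵛ-⊒⁺ p ν segs
expandᵛ-⊒⁺ {h} p@[] (N ∷ ν)   segs                 = expandᵛ-⊒⁺ {h} p ν segs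
expandᵛ-⊒⁺ p@(E ∷ _) (N ∷ ν) segs                 = expandᵛ-⊒⁺ p ν segs
expandᵛ-⊒⁺ p@(D ∷ _) (N ∷ ν) segs                 = expandᵛ-⊒⁺ p ν segs
expandᵛ-⊒⁺ []        []      []                   = []
expandᵛ-⊒⁺ (E ∷ p)   (E ∷ ν) (seg ∷ segs)         = seg ∷ expandᵛ-⊒⁺ p ν segs
expandᵛ-⊒⁺ (D ∷ p)   (E ∷ ν) ((k≤h , _) ∷ segs)   = (k≤h , k≤h) ∷ expandᵛ-⊒⁺ p ν segs

expandᵛ-⊒⁻ : ∀ {h k} p ν →
             Pointwise _⊒_ (segments h (toSchröder (expandᵛ p))) (segments k (toSchröder ν)) →
             Pointwise _⊒_ (segments h p) (segments k (toSchröder ν))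
expandᵛ-⊒⁻ (N ∷ p)   ν       segs                 = expandᵛ-⊒⁻ p ν segs
expandᵛ-⊒⁻ {h} p@[] (N ∷ ν)   segs                 = expandᵛ-⊒⁻ {h} p ν segs
expandᵛ-⊒⁻ p@(E ∷ _) (N ∷ ν) segs                 = expandᵛ-⊒⁻ p ν segs
expandᵛ-⊒⁻ p@(D ∷ _) (N ∷ ν) segs                 = expandᵛ-⊒⁻ p ν segs
expandᵛ-⊒⁻ []        []      []                   = []
expandᵛ-⊒⁻ (E ∷ p)   (E ∷ ν) (seg ∷ segs)         = seg ∷ expandᵛ-⊒⁻ p ν segs
expandᵛ-⊒⁻ (D ∷ p)   (E ∷ ν) ((k≤h , _) ∷ segs)   =
  (k≤h , ℕ.m≤n⇒m≤1+n k≤h) ∷ expandᵛ-⊒⁻ p ν segs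

-- Right ends suffice: both in `expand p` and in `ν`, the E belonging to a D runs at the height
-- where that D ends.
expand-⊒⁺ : ∀ {h k} p ν → Pointwise _⊒_ (segments h p) (segments k (contractPeaks ν)) →
            Pointwise _⊒_ (segments h (toSchröder (expand p))) (segments k (toSchröder ν))
expand-⊒⁺ (N ∷ p)   ν           segs                 = expand-⊒⁺ p ν segs
expand-⊒⁺ []        []          []                   = []
expand-⊒⁺ []        (N ∷ [])    []                   = []
expand-⊒⁺ {h} []    (N ∷ N ∷ ν) segs                 = expand-⊒⁺ {h} [] (N ∷ ν) segs
expand-⊒⁺ p@(E ∷ _) (N ∷ N ∷ ν) segs                 = expand-⊒⁺ p (N ∷ ν) segs
expand-⊒⁺ p@(D ∷ _) (N ∷ N ∷ ν) segs                 = expand-⊒⁺ p (N ∷ ν) segs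
expand-⊒⁺ (E ∷ p)   (E ∷ ν)     (seg ∷ segs)         = seg ∷ expand-⊒⁺ p ν segs
expand-⊒⁺ (D ∷ p)   (E ∷ ν)     ((_ , k≤h′) ∷ segs)  = (k≤h′ , k≤h′) ∷ expand-⊒⁺ p ν segs
expand-⊒⁺ (E ∷ p)   (N ∷ E ∷ ν) ((_ , k<h) ∷ segs)   = (k<h , k<h) ∷ expand-⊒⁺ p ν segs
expand-⊒⁺ (D ∷ p)   (N ∷ E ∷ ν) ((_ , k<h′) ∷ segs)  = (k<h′ , k<h′) ∷ expand-⊒⁺ p ν segs

-- Where expand raises a D of p above an E of ν of height k, the D itself starts
-- at height k or more because p is already above ν at the end of the preceding
-- column; a preceding N would have made that E part of a peak.
expand-⊒⁻ : ∀ {h k} p ν → (head ν ≡ just E → k ≤ h) →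
            Pointwise _⊒_ (segments h (toSchröder (expand p))) (segments k (toSchröder ν)) →
            Pointwise _⊒_ (segments h p) (segments k (contractPeaks ν))
expand-⊒⁻ (N ∷ p)   ν           k≤h segs         = expand-⊒⁻ p ν (ℕ.m≤n⇒m≤1+n ∘ k≤h) segs
expand-⊒⁻ []        []          _   []           = []
expand-⊒⁻ []        (N ∷ [])    _   []           = []
expand-⊒⁻ {h} []    (N ∷ N ∷ ν) _   segs         = expand-⊒⁻ {h} [] (N ∷ ν) (λ ()) segs
expand-⊒⁻ p@(E ∷ _) (N ∷ N ∷ ν) _   segs         = expand-⊒⁻ p (N ∷ ν) (λ ()) segs
expand-⊒⁻ p@(D ∷ _) (N ∷ N ∷ ν) _   segs         = expand-⊒⁻ p (N ∷ ν) (λ ()) segs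
expand-⊒⁻ (E ∷ p)   (E ∷ ν)     k≤h (seg ∷ segs) = seg ∷ expand-⊒⁻ p ν (λ _ → k≤h refl) segs
expand-⊒⁻ (D ∷ p)   (E ∷ ν)     k≤h ((_ , k≤h′) ∷ segs) =
  (k≤h refl , k≤h′) ∷ expand-⊒⁻ p ν (λ _ → k≤h′) segs
expand-⊒⁻ (E ∷ p)   (N ∷ E ∷ ν) _   ((k<h , _) ∷ segs) =
  (ℕ.<⇒≤ k<h , k<h) ∷ expand-⊒⁻ p ν (λ _ → k<h) segs
expand-⊒⁻ (D ∷ p)   (N ∷ E ∷ ν) _   ((k<h′ , _) ∷ segs) =
  (ℕ.s≤s⁻¹ k<h′ , k<h′) ∷ expand-⊒⁻ p ν (λ _ → k<h′) segs

-- Small and large Schröder paths as preimages, and the final count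

𝓟⇔expandᵛ≽ : ∀ ν p → 𝓟 ν p ⇔ expandᵛ p ≽ ν
𝓟⇔expandᵛ≽ ν p = mk⇔
  (λ (end≡ , above) → trans (endpoint-expandᵛ p) end≡ ,
    expandᵛ-⊒⁺ p ν (weaklyAbove⇒⊒ p (toSchröder ν) (cong proj₁ end≡) above))
  (λ (end≡ , segs) → trans (sym (endpoint-expandᵛ p)) end≡ ,
    ⊒⇒weaklyAbove p (toSchröder ν) (expandᵛ-⊒⁻ p ν segs))

𝓛𝓟⇔expand≽ : ∀ ν p → 𝓛𝓟 ν p ⇔ expand p ≽ ν
𝓛𝓟⇔expand≽ ν p = mk⇔
  (λ (end≡ , above) → trans (endpoint-expand p) end≡ ,
    expand-⊒⁺ p ν (weaklyAbove⇒⊒ p (contractPeaks ν)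
      (cong proj₁ (trans end≡ (sym (endpoint-contractPeaks ν)))) above))
  (λ (end≡ , segs) → trans (sym (endpoint-expand p)) end≡ ,
    -- Both paths start at height 0, which settles the condition on an initial E of `ν`.
    ⊒⇒weaklyAbove p (contractPeaks ν) (expand-⊒⁻ p ν (λ _ → ℕ.z≤n) segs))

theorem2p3 : (ν : LatticePath) →
    ∃[ l ] ∃[ s ] (HasCardinality (𝓛𝓟 ν) l × HasCardinality (𝓟 ν) s ×
    (l ≡ 2 * s ⇔ (head ν ≡ just N × last ν ≡ just E)))
theorem2p3 ν =
  sum (map #contractions πs) , sum (map #contractionsᵛ πs) ,
  hasCardinality-preimage expand contractions ∈-contractions⇔ contractions-unique
    πs (pathsAbove-unique ν) (∈-pathsAbove⇔ ν) (𝓛𝓟⇔expand≽ ν) ,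
  hasCardinality-preimage expandᵛ contractionsᵛ ∈-contractionsᵛ⇔ contractionsᵛ-unique
    πs (pathsAbove-unique ν) (∈-pathsAbove⇔ ν) (𝓟⇔expandᵛ≽ ν) ,
  mk⇔ only-if if
  where
  πs = pathsAbove ν

  only-if : sum (map #contractions πs) ≡ 2 * sum (map #contractionsᵛ πs) → StartsNorthEndsEast ν
  only-if l≡2s with startsNorthEndsEast? ν
  ... | yes good = good
  ... | no  bad  = contradiction l≡2s (ℕ.<⇒≢ (sum-<-double #contractions #contractionsᵛ
    #contractions≤ (from (∈-pathsAbove⇔ ν ν) (≽-refl ν)) (unbalanced ν bad)))

  if : StartsNorthEndsEast ν → sum (map #contractions πs) ≡ 2 * sum (map #contractionsᵛ πs)
  if good = sum-≡-double #contractions #contractionsᵛ (All.tabulate λ {π} π∈ →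
    balanced π (≽-startsNorthEndsEast π ν (to (∈-pathsAbove⇔ ν π) π∈) good))
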